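{- Let $T$ be a tree on $n$ vertices. Then $k(T)=3$ if and only if $T\in\mathcal{T}$.
   Context: For a vertex $v$ of a connected graph $G=(V,E)$, the status of $v$ is $s(v)=\sum_{u\in V} d(v,u)$, where $d$ is the shortest-path distance. $k(G)$ denotes the number of distinct values among the statuses of the vertices of $G$. A star is $K_{1,m}$ with $m\ge 2$. A balanced double star is a graph obtained from $K_2$ by appending $a\ge 1$ pendant vertices to each of its two vertices. $\mathcal{T}$ is the family of trees obtainable by appending the same number $b\ge 1$ of pendant vertices to each leaf of a star, or to each leaf of a balanced double star. -}

module Defs where

open import Data.Bool using (Bool; true; false; if_then_else_; _∨_; _∧_)
open import Data.Nat using (ℕ; zero; suc; _≤_)
import Data.Nat as ℕ
open import Data.Fin using (Fin; _≟_)
import Data.Fin as F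
open import Data.List using (List; []; _∷_; _++_; length; map; allFin; deduplicate)
open import Data.Bool.ListAction using (any)
open import Data.Nat.ListAction using (sum)
open import Data.Sum using (_⊎_)
open import Data.List.Relation.Unary.Linked using (Linked)
open import Data.List.Relation.Unary.Unique.Propositional using (Unique)
open import Data.Product using (Σ; ∃; _×_)
open import Data.Empty using (⊥)
open import Relation.Nullary using (¬_)
open import Relation.Nullary.Decidable using (⌊_⌋)
open import Relation.Binary.PropositionalEquality using (_≡_; _≢_)
open import Function.Bundles using (_⤖_; _⇔_; Bijection)

record Graph (n : ℕ) : Set where
  field
    adj   : Fin n → Fin n → Bool
    sym   : ∀ u v → adj u v ≡ adj v u
    irrefl : ∀ u → adj u u ≡ false
open Graph public

module _ {n : ℕ} (G : Graph n) where

  Adj : Fin n → Fin n → Set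
  Adj u v = adj G u v ≡ true

  data Walk : Fin n → Fin n → Set where
    here : ∀ {u} → Walk u u
    step : ∀ {u w v} → Adj u w → Walk w v → Walk u v

  Connected : Set
  Connected = ∀ u v → Walk u v

  IsCycle : Fin n → List (Fin n) → Set
  IsCycle x xs = (3 ≤ length (x ∷ xs)) × Unique (x ∷ xs) × Linked Adj (x ∷ xs ++ x ∷ [])

  Acyclic : Set
  Acyclic = ∀ x xs → ¬ IsCycle x xs

  IsTree : Set
  IsTree = Connected × Acyclic

  reach : ℕ → Fin n → Fin n → Bool
  reach zero u v = ⌊ u ≟ v ⌋
  reach (suc k) u v = reach k u v ∨ any (λ w → reach k u w ∧ adj G w v) (allFin n)

-- least k < b with f k = true (b if none)
least : ℕ → (ℕ → Bool) → ℕ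
least zero f = zero
least (suc b) f = if f zero then zero else suc (least b (λ k → f (suc k)))

module _ {n : ℕ} (G : Graph n) where

  -- shortest-path distance: least k with a walk of length ≤ k
  -- (a walk exists within n steps whenever G is connected)
  dist : Fin n → Fin n → ℕ
  dist u v = least n (λ k → reach G k u v)

  status : Fin n → ℕ
  status v = sum (map (dist v) (allFin n))

  kG : ℕ
  kG = length (deduplicate ℕ._≟_ (map status (allFin n)))

-- star K_{1,m} with b pendants appended to each of its m leaves
data SV (m b : ℕ) : Set where
  c : SV m b
  l : Fin m → SV m b
  p : Fin m → Fin b → SV m b

data SAdj {m b : ℕ} : SV m b → SV m b → Set where
  cl : ∀ i → SAdj c (l i)
  lc : ∀ i → SAdj (l i) c
  lp : ∀ i j → SAdj (l i) (p i j)
  pl : ∀ i j → SAdj (p i j) (l i)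

-- balanced double star (centres c s, s : Fin 2, each with a leaves l s i)
-- with b pendants appended to each of its 2a leaves
data DV (a b : ℕ) : Set where
  c : Fin 2 → DV a b
  l : Fin 2 → Fin a → DV a b
  p : Fin 2 → Fin a → Fin b → DV a b

data DAdj {a b : ℕ} : DV a b → DV a b → Set where
  cc : ∀ s t → s ≢ t → DAdj (c s) (c t)
  cl : ∀ s i → DAdj (c s) (l s i)
  lc : ∀ s i → DAdj (l s i) (c s)
  lp : ∀ s i j → DAdj (l s i) (p s i j)
  pl : ∀ s i j → DAdj (p s i j) (l s i)

IsoTo : ∀ {n} → Graph n → (V : Set) → (V → V → Set) → Set
IsoTo {n} G V R = Σ (Fin n ⤖ V) λ φ →
  ∀ u v → (Adj G u v ⇔ R (Bijection.to φ u) (Bijection.to φ v))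

InFamilyT : ∀ {n} → Graph n → Set
InFamilyT G =
    (Σ ℕ λ m → Σ ℕ λ b → (2 ≤ m) × (1 ≤ b) × IsoTo G (SV m b) SAdj)
  ⊎ (Σ ℕ λ a → Σ ℕ λ b → (1 ≤ a) × (1 ≤ b) × IsoTo G (DV a b) DAdj)

{-# OPTIONS --safe #-}
module Submission where

-- Deleting an edge vw of a tree leaves two branches, and s(v) − s(w) is the difference of their sizes;
-- hence the status is strictly convex along paths. So the minimum is attained at one vertex or at two adjacent
-- ones, and the status strictly increases along every path leaving this median. With only three values, the tree
-- has depth two around the median. By counting branches, a kid of the median carrying no leaf would have a status
-- strictly between those of a leaf-bearing kid and its leaves, which would make four values; and leaf-bearing
-- kids, having equal statuses, carry equally many leaves. For two median vertices, equal statuses force equal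
-- branches and hence equal degrees.

open import Defs
open import Data.Bool using (true; false; if_then_else_; _∧_)
import Data.Bool.Properties as Bool
open import Data.Empty using (⊥; ⊥-elim)
open import Data.Fin using (Fin; zero; suc; _≟_)
open import Data.Fin.Properties using (any?; injective⇒≤)
open import Data.List using (List; []; _∷_; _++_; length; map; allFin; tabulate; filter; lookup; deduplicate)
open import Data.List.Membership.Propositional using (_∈_; _∉_)
open import Data.List.Membership.Propositional.Properties
  using (∈-∃++; ∈-lookup; ∈-allFin; ∈-deduplicate⁺; ∈-deduplicate⁻; ∈-map⁺; ∈-map⁻;
         ∈-tabulate⁺; ∈-tabulate⁻; ∈-filter⁺; ∈-filter⁻; ∈-length)
import Data.List.Membership.Setoid.Properties as Membershipₛ
import Data.List.Membership.DecPropositional as DecMembership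
open import Data.List.Properties using (map-tabulate; length-map; length-tabulate)
open import Data.List.Relation.Unary.All as All using ([]; _∷_)
open import Data.List.Relation.Unary.All.Properties using (¬Any⇒All¬)
open import Data.List.Relation.Unary.AllPairs as AllPairs using ([]; _∷_)
open import Data.List.Relation.Unary.Any as Any using (here; there)
open import Data.List.Relation.Unary.Any.Properties as Anyₚ using (lookup-index)
open import Data.List.Relation.Unary.Linked using (Linked; [-]; _∷_)
open import Data.List.Relation.Unary.Linked.Properties using (Linked⇒AllPairs)
import Data.List.Extrema.Nat as Extrema
open import Data.List.Relation.Unary.Unique.Propositional using (Unique)
open import Data.List.Relation.Unary.Unique.Propositional.Properties using (Unique[x∷xs]⇒x∉xs; filter⁺; allFin⁺; tabulate⁺)
open import Data.List.Relation.Unary.Unique.DecPropositional.Properties using (deduplicate-!)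
open import Data.Nat using (ℕ; zero; suc; _+_; _*_; _∸_; _≤_; _<_; z≤n; s≤s)
import Data.Nat as ℕ
open import Data.Nat.ListAction using (sum)
open import Data.Nat.Properties hiding (_≟_)
open import Algebra.Properties.Semiring.Sum +-*-semiring
  using (sum-cong-≗; ∑-distrib-+; ∑-comm; *-distribʳ-sum) renaming (sum to ∑)
open import Data.Nat.Tactic.RingSolver using (solve-∀)
open import Data.Product using (∃; _×_; _,_; proj₁; proj₂)
open import Data.Sum using (_⊎_; inj₁; inj₂)
open import Data.Unit using (⊤; tt)
open import Function using (_∘_; id)
open import Function.Bundles using (_⇔_; Bijection; Equivalence; mk⇔; mk⤖)
open import Relation.Binary.Definitions using (tri<; tri≈; tri>)
open import Relation.Binary.PropositionalEquality as ≡ using (_≡_; _≢_; refl; cong; cong₂; subst)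
open import Relation.Nullary using (¬_; Dec; yes; no; does; contradiction; ¬?; _×-dec_)
open import Relation.Nullary.Decidable using (decidable-stable)

-- Passing from v to w brings the branch of w one step nearer and moves the other branch one step
-- away, so s(w) = s(v) + n - 2β, with β the size of the branch of w. A leaf therefore lies exactly
-- n - 2 above its neighbour, and a kid that bears leaves lies less far above the median, since β ≥
-- 2 there; this is what places a leafless kid strictly in between. For the converse the same
-- formula makes the status constant on each of the three levels of a member of the family, and
-- convexity separates the levels. Distances are defined by a bounded Boolean search.
-- Non-backtracking walks, which are unique in an acyclic graph, turn them into lengths of lists.
-- Branch sizes are sums of indicators, so that every count is an interchange or a pointwise
-- comparison of finite sums. One and two median vertices are handled together, as a pair `z₀`, `z₁`
-- that may coincide.

private variable
  A : Set
  k n : ℕ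
  x y : A
  xs ys : List A

-- Lists without repetition

lookup-injective : Unique xs → ∀ {i j} → lookup xs i ≡ lookup xs j → i ≡ j
lookup-injective (_ ∷ _)  {zero}  {zero}  _  = refl
lookup-injective (x∉ ∷ _) {zero}  {suc j} eq = contradiction eq (All.lookup x∉ (∈-lookup j))
lookup-injective (x∉ ∷ _) {suc i} {zero}  eq = contradiction (≡.sym eq) (All.lookup x∉ (∈-lookup i))
lookup-injective (_ ∷ xs!) {suc i} {suc j} eq = cong suc (lookup-injective xs! eq)

-- Pigeonhole: sending each position of `xs` to a position of the same element in `ys` is injective.
Unique-⊆⇒length≤ : Unique xs → (∀ {x} → x ∈ xs → x ∈ ys) → length xs ≤ length ys
Unique-⊆⇒length≤ xs! xs⊆ys = injective⇒≤ {f = λ i → Any.index (xs⊆ys (∈-lookup i))}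
  λ {i} {j} eq → lookup-injective xs!
    (Membershipₛ.index-injective (≡.setoid _) (xs⊆ys (∈-lookup i)) (xs⊆ys (∈-lookup j)) eq)

Linked-prefix : ∀ {R : A → A → Set} xs → Linked R (xs ++ x ∷ ys) → Linked R (xs ++ x ∷ [])
Linked-prefix []           _        = [-]
Linked-prefix (_ ∷ [])     (r ∷ _)  = r ∷ [-]
Linked-prefix (_ ∷ y ∷ xs) (r ∷ rs) = r ∷ Linked-prefix (y ∷ xs) rs

-- The repeated vertex moves to the front because `IsCycle` lists its base point first.
Unique-prefix : ∀ (xs : List A) → Unique (xs ++ x ∷ ys) → Unique (x ∷ xs)
Unique-prefix xs xs! = All.tabulate (fresh xs xs!) ∷ initial xs xs!
  where
  fresh : ∀ (xs : List A) → Unique (xs ++ x ∷ ys) → y ∈ xs → x ≢ y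
  fresh (y ∷ xs) (y∉ ∷ _) (here refl) = All.lookup y∉ (Anyₚ.++⁺ʳ xs (here refl)) ∘ ≡.sym
  fresh (_ ∷ xs) (_ ∷ xs!) (there y∈) = fresh xs xs! y∈
  initial : ∀ (xs : List A) → Unique (xs ++ x ∷ ys) → Unique xs
  initial []       _          = []
  initial (_ ∷ xs) (y∉ ∷ xs!) = All.tabulate (λ z∈ → All.lookup y∉ (Anyₚ.++⁺ˡ z∈)) ∷ initial xs xs!

-- The bound `k < b` keeps the search away from its default value `b`.
least-unique : ∀ b (f : ℕ → _) → f k ≡ true → k < b → (∀ j → f j ≡ true → k ≤ j) → least b f ≡ k
least-unique {zero} (suc b) f fk _ _ rewrite fk = refl
least-unique {suc k} (suc b) f fk (s≤s k<b) k-least with f zero in f0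
... | true  = contradiction (k-least zero f0) λ ()
... | false = cong suc (least-unique b (f ∘ suc) fk k<b λ j fj → ≤-pred (k-least (suc j) fj))

-- Indicators and finite sums

⟦_⟧ : Dec A → ℕ
⟦ A? ⟧ = if does A? then 1 else 0

⟦⟧-yes : (A? : Dec A) → A → ⟦ A? ⟧ ≡ 1
⟦⟧-yes (yes _) _ = refl
⟦⟧-yes (no ¬a) a = contradiction a ¬a

⟦⟧-no : (A? : Dec A) → ¬ A → ⟦ A? ⟧ ≡ 0
⟦⟧-no (yes a) ¬a = contradiction a ¬a
⟦⟧-no (no _)  _  = refl

⟦⟧≤1 : (A? : Dec A) → ⟦ A? ⟧ ≤ 1
⟦⟧≤1 (yes _) = ≤-refl
⟦⟧≤1 (no _)  = z≤n

sum-tabulate : (f : Fin n → ℕ) → sum (tabulate f) ≡ ∑ f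
sum-tabulate {zero}  f = refl
sum-tabulate {suc n} f = cong (f zero +_) (sum-tabulate (f ∘ suc))

length-filter-tabulate : {P : A → Set} (P? : ∀ a → Dec (P a)) (f : Fin n → A) →
                         length (filter P? (tabulate f)) ≡ ∑ (λ i → ⟦ P? (f i) ⟧)
length-filter-tabulate {n = zero}  P? f = refl
length-filter-tabulate {n = suc n} P? f with P? (f zero)
... | yes _ = cong suc (length-filter-tabulate P? (f ∘ suc))
... | no _  = length-filter-tabulate P? (f ∘ suc)

∑-zero : ∑ {n} (λ _ → 0) ≡ 0
∑-zero {zero}  = refl
∑-zero {suc n} = ∑-zero {n}

∑-one : ∑ {n} (λ _ → 1) ≡ n
∑-one {zero}  = refl
∑-one {suc n} = cong suc ∑-one

∑-mono : {f g : Fin n → ℕ} → (∀ i → f i ≤ g i) → ∑ f ≤ ∑ g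
∑-mono {zero}  _   = z≤n
∑-mono {suc n} f≤g = +-mono-≤ (f≤g zero) (∑-mono (f≤g ∘ suc))

∑-δ : (j : Fin n) → ∑ (λ i → ⟦ i ≟ j ⟧) ≡ 1
∑-δ {suc n} zero    = cong suc (∑-zero {n})
∑-δ {suc n} (suc j) = ∑-δ j

∑-unique : {P : Fin n → Set} (P? : ∀ i → Dec (P i)) {j : Fin n} →
           P j → (∀ i → P i → i ≡ j) → ∑ (λ i → ⟦ P? i ⟧) ≡ 1
∑-unique P? {j} pj unique = ≡.trans (sum-cong-≗ agree) (∑-δ j)
  where
  agree : ∀ i → ⟦ P? i ⟧ ≡ ⟦ i ≟ j ⟧
  agree i with i ≟ j
  ... | yes refl = ⟦⟧-yes (P? i) pj
  ... | no i≢j   = ⟦⟧-no (P? i) (i≢j ∘ unique i)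

-- Non-backtracking walks and distance

module _ {n : ℕ} (G : Graph n) where

  Adj-sym : ∀ {u v} → Adj G u v → Adj G v u
  Adj-sym {u} {v} = ≡.trans (sym G v u)

  Adj-irrefl : ∀ {u} → ¬ Adj G u u
  Adj-irrefl {u} uu = contradiction (≡.trans (≡.sym uu) (irrefl G u)) λ ()

  Adj? : ∀ u v → Dec (Adj G u v)
  Adj? u v = adj G u v Bool.≟ true

  _≢head_ : Fin n → List (Fin n) → Set
  u ≢head []      = ⊤
  u ≢head (v ∷ _) = u ≢ v

  -- Non-backtracking walks; the list holds the vertices after the first.
  data Path : Fin n → List (Fin n) → Fin n → Set where
    []   : ∀ {u} → Path u [] u
    cons : ∀ {u v w xs} → Adj G u v → u ≢head xs → Path v xs w → Path u (v ∷ xs) w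

  _∈?_ = DecMembership._∈?_ (_≟_ {n})

  last∈ : ∀ {u v w xs} → Path u (v ∷ xs) w → w ∈ v ∷ xs
  last∈ (cons _ _ [])             = here refl
  last∈ (cons _ _ q@(cons _ _ _)) = there (last∈ q)

  -- Prepending an edge fails only if the path turns straight back to `u`; the two edges then
  -- cancel. This dichotomy later decides which end of an edge is nearer to a given vertex.
  extend : ∀ {u v w xs} → Adj G u v → Path v xs w →
           Path u (v ∷ xs) w ⊎ ∃ λ ys → xs ≡ u ∷ ys × Path u ys w
  extend uv [] = inj₁ (cons uv tt [])
  extend {u} uv q@(cons {v = y} _ _ q′) with u ≟ y
  ... | yes refl = inj₂ (_ , refl , q′)
  ... | no u≢y   = inj₁ (cons uv u≢y q)

  -- Cancellation can only shorten a path, hence an inequality for the length.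
  snoc : ∀ {u v w xs} → Path u xs v → Adj G v w → ∃ λ ys → Path u ys w × length ys ≤ suc (length xs)
  snoc [] vw = _ , cons vw tt [] , ≤-refl
  snoc (cons ux _ q) vw with snoc q vw
  ... | ys , q′ , ys≤ with extend ux q′
  ...   | inj₁ q″               = _ , q″ , s≤s ys≤
  ...   | inj₂ (zs , refl , q″) = zs , q″ , m≤n⇒m≤1+n (≤-trans (n≤1+n _) ys≤)

  Walk⇒Path : ∀ {u v} → Walk G u v → ∃ λ xs → Path u xs v
  Walk⇒Path here = [] , []
  Walk⇒Path (step uw w) with extend uw (proj₂ (Walk⇒Path w))
  ... | inj₁ q           = _ , q
  ... | inj₂ (_ , _ , q) = _ , q

  reach-suc⁻ : ∀ k {u v} → reach G (suc k) u v ≡ true →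
               reach G k u v ≡ true ⊎ ∃ λ w → reach G k u w ≡ true × Adj G w v
  reach-suc⁻ k {u} {v} r with Equivalence.to Bool.T-∨ (Equivalence.from Bool.T-≡ r)
  ... | inj₁ r′ = inj₁ (Equivalence.to Bool.T-≡ r′)
  ... | inj₂ r′ with Any.satisfied (Anyₚ.any⁻ _ (allFin n) r′)
  ...   | w , rw with Equivalence.to Bool.T-∧ rw
  ...     | rk , wv = inj₂ (w , Equivalence.to Bool.T-≡ rk , Equivalence.to Bool.T-≡ wv)

  reach-suc⁺ : ∀ k {u v} → (reach G k u v ≡ true ⊎ ∃ λ w → reach G k u w ≡ true × Adj G w v) →
               reach G (suc k) u v ≡ true
  reach-suc⁺ k (inj₁ r) rewrite r = refl
  reach-suc⁺ k {u} {v} (inj₂ (w , r , wv)) = Equivalence.to Bool.T-≡ (Equivalence.from Bool.T-∨ (inj₂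
    (Anyₚ.any⁺ _ (Any.map (λ { refl → Equivalence.from Bool.T-≡ (cong₂ _∧_ r wv) }) (∈-allFin w)))))

  reach-refl : ∀ u → reach G zero u u ≡ true
  reach-refl u with u ≟ u
  ... | yes _  = refl
  ... | no u≢u = contradiction refl u≢u

  -- `reach` grows at its far end and `Path` at its start; this reconciles the two recursions.
  reach-step : ∀ k {u v w} → Adj G u v → reach G k v w ≡ true → reach G (suc k) u w ≡ true
  reach-step zero {u} {v} {w} uv r with v ≟ w
  ... | yes refl = reach-suc⁺ zero (inj₂ (u , reach-refl u , uv))
  ... | no _     = contradiction r λ ()
  reach-step (suc k) uv r with reach-suc⁻ k r
  ... | inj₁ r′            = reach-suc⁺ (suc k) (inj₁ (reach-step k uv r′))
  ... | inj₂ (x , r′ , xw) = reach-suc⁺ (suc k) (inj₂ (x , reach-step k uv r′ , xw))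

  reach⇒Path : ∀ k {u v} → reach G k u v ≡ true → ∃ λ xs → Path u xs v × length xs ≤ k
  reach⇒Path zero {u} {v} r with u ≟ v
  ... | yes refl = [] , [] , z≤n
  ... | no _     = contradiction r λ ()
  reach⇒Path (suc k) r with reach-suc⁻ k r
  ... | inj₁ r′ with reach⇒Path k r′
  ...   | xs , q , xs≤k = xs , q , m≤n⇒m≤1+n xs≤k
  reach⇒Path (suc k) r | inj₂ (w , r′ , wv) with reach⇒Path k r′
  ...   | xs , q , xs≤k with snoc q wv
  ...     | ys , q′ , ys≤ = ys , q′ , ≤-trans ys≤ (s≤s xs≤k)

  Path⇒reach : ∀ {u v xs} → Path u xs v → reach G (length xs) u v ≡ true
  Path⇒reach {u} [] = reach-refl u
  Path⇒reach {xs = _ ∷ xs} (cons uv _ q) = reach-step (length xs) uv (Path⇒reach q)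

  Path-linked : ∀ {u v xs} → Path u xs v → Linked (Adj G) (u ∷ xs)
  Path-linked []            = [-]
  Path-linked (cons uv _ q) = uv ∷ Path-linked q

  module _ (acyclic : Acyclic G) where

    -- A first repetition on a non-backtracking walk closes a cycle.
    Path-unique : ∀ {u v xs} → Path u xs v → Unique (u ∷ xs)
    Path-unique [] = [] ∷ []
    Path-unique {u} path@(cons {v = w} {xs = xs} uw turn q) = ¬Any⇒All¬ _ u∉ ∷ Path-unique q
      where
      u∉ : u ∉ w ∷ xs
      -- A return after one step is a loop and after two steps a backtrack; only from three steps on
      -- is `u ∷ pre` long enough for `IsCycle`.
      u∉ u∈ with ∈-∃++ u∈
      ... | [] , _ , refl = Adj-irrefl uw
      ... | _ ∷ [] , _ , refl = turn refl
      ... | pre@(_ ∷ _ ∷ _) , post , eq = acyclic u pre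
        ( s≤s (s≤s (s≤s z≤n))
        , Unique-prefix pre (subst Unique eq (Path-unique q))
        , Linked-prefix (u ∷ pre) (subst (λ zs → Linked (Adj G) (u ∷ zs)) eq (Path-linked path)))

    -- Moving the start along the first path keeps the two paths diverging, until the second is closed.
    no-diverging-paths : ∀ {u v w xs ys} → Path u xs w → Path u (v ∷ ys) w → v ≢head xs → ⊥
    no-diverging-paths [] q _ = Unique[x∷xs]⇒x∉xs (Path-unique q) (last∈ q)
    no-diverging-paths (cons uy turn q) q′ v≢y =
      no-diverging-paths q (cons (Adj-sym uy) (v≢y ∘ ≡.sym) q′) turn

    Path-irrelevant : ∀ {u v xs ys} → Path u xs v → Path u ys v → xs ≡ ys
    Path-irrelevant [] [] = refl
    Path-irrelevant [] q@(cons _ _ _) = ⊥-elim (no-diverging-paths [] q tt)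
    Path-irrelevant q@(cons _ _ _) [] = ⊥-elim (no-diverging-paths [] q tt)
    Path-irrelevant q@(cons {v = x} _ _ q₁) q′@(cons {v = y} _ _ q₂) with x ≟ y
    ... | yes refl = cong (x ∷_) (Path-irrelevant q₁ q₂)
    ... | no x≢y   = ⊥-elim (no-diverging-paths q q′ (x≢y ∘ ≡.sym))

    -- Any successful search within `k` steps yields a path of length at most `k`, and by uniqueness
    -- it is the given one.
    dist≡length : ∀ {u v xs} → Path u xs v → dist G u v ≡ length xs
    dist≡length {xs = xs} q = least-unique n _ (Path⇒reach q)
      -- The path visits `suc (length xs)` distinct vertices, so its length is below `n`, the
      -- default of `least`.
      (injective⇒≤ (lookup-injective (Path-unique q))) shortest
      where
      shortest : ∀ k → reach G k _ _ ≡ true → length xs ≤ k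
      shortest k r with reach⇒Path k r
      ... | _ , q′ , ≤k rewrite Path-irrelevant q q′ = ≤k

-- Labellings by the model trees

-- Runs from the model to the graph, opposite to `IsoTo`, so that vertices are named by constructors
-- and every field can be proved by matching on them.
record Labelling (G : Graph n) (V : Set) (R : V → V → Set) : Set where
  field
    at         : V → Fin n
    injective  : ∀ x y → at x ≡ at y → x ≡ y
    surjective : ∀ v → ∃ λ x → at x ≡ v
    adj⁺       : ∀ {x y} → R x y → Adj G (at x) (at y)
    adj⁻       : ∀ x y → Adj G (at x) (at y) → R x y

Labelling⇒IsoTo : ∀ {G : Graph n} {V R} → Labelling G V R → IsoTo G V R
Labelling⇒IsoTo {G = G} {R = R} L = mk⤖ (to-injective , to-surjective) , λ u v → mk⇔
    (λ uv → adj⁻ _ _ (≡.subst₂ (Adj G) (≡.sym (at-to u)) (≡.sym (at-to v)) uv))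
    (λ r → ≡.subst₂ (Adj G) (at-to u) (at-to v) (adj⁺ r))
  where
  open Labelling L
  to = λ v → proj₁ (surjective v)
  at-to = λ v → proj₂ (surjective v)
  to-injective : ∀ {u v} → to u ≡ to v → u ≡ v
  to-injective {u} {v} e = ≡.trans (≡.sym (at-to u)) (≡.trans (cong at e) (at-to v))
  to-surjective : ∀ x → ∃ λ v → ∀ {w} → w ≡ v → to w ≡ x
  to-surjective x = at x , λ { refl → injective _ _ (at-to (at x)) }

IsoTo⇒Labelling : ∀ {G : Graph n} {V R} → IsoTo G V R → Labelling G V R
IsoTo⇒Labelling {G = G} {R = R} (φ , iso) = record
  { at         = from
  ; injective  = λ x y e → ≡.trans (≡.sym (to-from x)) (≡.trans (cong to e) (to-from y))
  ; surjective = λ v → to v , Bijection.injective φ (to-from (to v))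
  ; adj⁺       = λ {x} {y} r → Equivalence.from (iso _ _) (≡.subst₂ R (≡.sym (to-from x)) (≡.sym (to-from y)) r)
  ; adj⁻       = λ x y e → ≡.subst₂ R (to-from x) (to-from y) (Equivalence.to (iso _ _) e)
  }
  where
  to = Bijection.to φ
  from = λ x → proj₁ (Bijection.surjective φ x)
  to-from : ∀ x → to (from x) ≡ x
  to-from x = proj₂ (Bijection.surjective φ x) refl

-- Bounds for the number of statuses

module _ (G : Graph n) where

  kG≤length : ∀ {ks} → (∀ v → status G v ∈ ks) → kG G ≤ length ks
  kG≤length {ks} covered = Unique-⊆⇒length≤ (deduplicate-! ℕ._≟_ (map (status G) (allFin n))) λ k∈ →
    let _ , _ , k≡ = ∈-map⁻ (status G) (∈-deduplicate⁻ ℕ._≟_ _ k∈) in subst (_∈ ks) (≡.sym k≡) (covered _)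

  -- Strictly increasing statuses are distinct. With four vertices this becomes the contradiction
  -- `no-four`, which determines the shape of the tree.
  length≤kG : ∀ vs → Linked _<_ (map (status G) vs) → length vs ≤ kG G
  length≤kG vs increasing = ≤-trans (≤-reflexive (≡.sym (length-map (status G) vs)))
    (Unique-⊆⇒length≤ (AllPairs.map <⇒≢ (Linked⇒AllPairs <-trans increasing)) λ k∈ →
      let v , _ , k≡ = ∈-map⁻ (status G) k∈ in
      ∈-deduplicate⁺ ℕ._≟_ (subst (_∈ map (status G) (allFin n)) (≡.sym k≡) (∈-map⁺ (status G) (∈-allFin v))))

  kG≡3 : ∀ {u v w} → status G u < status G v → status G v < status G w →
         (∀ x → status G x ∈ status G u ∷ status G v ∷ status G w ∷ []) → kG G ≡ 3
  kG≡3 {u} {v} {w} u<v v<w covered =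
    ≤-antisym (kG≤length covered) (length≤kG (u ∷ v ∷ w ∷ []) (u<v ∷ v<w ∷ [-]))

-- Statuses and branch sizes in a tree

module Tree {n : ℕ} {G : Graph n} (tree : IsTree G) where

  private
    d : Fin n → Fin n → ℕ
    d = dist G

    s : Fin n → ℕ
    s = status G

    acyclic : Acyclic G
    acyclic = proj₂ tree

    path : ∀ u v → ∃ λ xs → Path G u xs v
    path u v = Walk⇒Path G (proj₁ tree u v)

  dist-refl : ∀ v → d v v ≡ 0
  dist-refl v = dist≡length G acyclic []

  -- The path from `w` to `x` either extends by the edge or begins with it, so the two distances are
  -- never equal.
  dist-step : ∀ {v w} → Adj G v w → ∀ x → d v x ≡ suc (d w x) ⊎ d w x ≡ suc (d v x)
  dist-step {v} {w} vw x with path w x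
  ... | xs , q with extend G vw q
  ...   | inj₁ q′ = inj₁ (≡.trans (dist≡length G acyclic q′) (cong suc (≡.sym (dist≡length G acyclic q))))
  ...   | inj₂ (ys , refl , q′) =
    inj₂ (≡.trans (dist≡length G acyclic q) (cong suc (≡.sym (dist≡length G acyclic q′))))

  -- Expresses by distances that `x` lies on the side of `w` when the edge `vw` is deleted.
  -- Including adjacency makes the branch towards a non-neighbour empty.
  Closer : Fin n → Fin n → Fin n → Set
  Closer v w x = Adj G v w × d v x ≡ suc (d w x)

  closer-exists : ∀ {v x} → x ≢ v → ∃ λ w → Closer v w x
  closer-exists {v} {x} x≢v with path v x
  ... | [] , [] = contradiction refl x≢v
  ... | w ∷ _ , q@(cons vw _ q′) =
    w , vw , ≡.trans (dist≡length G acyclic q) (cong suc (≡.sym (dist≡length G acyclic q′)))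

  -- If prepending `v` backtracked, `x` would be nearer to `v` than to `w`.
  closer⇒Path : ∀ {v w x} → Closer v w x → ∃ λ xs → Path G v (w ∷ xs) x
  closer⇒Path {v} {w} {x} (vw , d≡) with path w x
  ... | xs , q with extend G vw q
  ...   | inj₁ q′ = xs , q′
  ...   | inj₂ (ys , refl , q′) = contradiction
    (≡.trans (≡.trans (≡.sym (dist≡length G acyclic q′)) d≡) (cong suc (dist≡length G acyclic q)))
    (m≢1+n+m (length ys) {1})

  -- Both are the second vertex of the one path from `v` to `x`; hence distinct branches at `v` are
  -- disjoint.
  closer-unique : ∀ {v w w′ x} → Closer v w x → Closer v w′ x → w ≡ w′
  closer-unique vwx vw′x with closer⇒Path vwx | closer⇒Path vw′x
  ... | _ , q | _ , q′ with Path-irrelevant G acyclic q q′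
  ...   | refl = refl

  closer? : ∀ v w x → Dec (Closer v w x)
  closer? v w x = Adj? G v w ×-dec (d v x ℕ.≟ suc (d w x))

  -- The number of vertices of the component of w after deleting an edge vw (0 if vw is not an edge).
  branch : Fin n → Fin n → ℕ
  branch v w = ∑ λ x → ⟦ closer? v w x ⟧

  status≡∑ : ∀ v → s v ≡ ∑ (d v)
  status≡∑ v = ≡.trans (cong sum (map-tabulate id (d v))) (sum-tabulate (d v))

  ⟦closer⟧ : ∀ {v w} → Adj G v w → ∀ x →
             (d v x ≡ suc (d w x) × ⟦ closer? v w x ⟧ ≡ 1 × ⟦ closer? w v x ⟧ ≡ 0) ⊎
             (d w x ≡ suc (d v x) × ⟦ closer? v w x ⟧ ≡ 0 × ⟦ closer? w v x ⟧ ≡ 1)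
  ⟦closer⟧ {v} {w} vw x with dist-step vw x
  ... | inj₁ e = inj₁ (e , ⟦⟧-yes (closer? v w x) (vw , e) ,
    ⟦⟧-no (closer? w v x) (λ (_ , e′) → m≢1+n+m (d w x) {1} (≡.trans e′ (cong suc e))))
  ... | inj₂ e = inj₂ (e ,
    ⟦⟧-no (closer? v w x) (λ (_ , e′) → m≢1+n+m (d v x) {1} (≡.trans e′ (cong suc e))) ,
    ⟦⟧-yes (closer? w v x) (Adj-sym G vw , e))

  branch-complement : ∀ {v w} → Adj G v w → branch v w + branch w v ≡ n
  branch-complement {v} {w} vw = begin
    branch v w + branch w v                               ≡⟨ ∑-distrib-+ (λ x → ⟦ closer? v w x ⟧) _ ⟨
    ∑ (λ x → ⟦ closer? v w x ⟧ + ⟦ closer? w v x ⟧)       ≡⟨ sum-cong-≗ pointwise ⟩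
    ∑ {n} (λ _ → 1)                                       ≡⟨ ∑-one ⟩
    n                                                     ∎
    where
    open ≡.≡-Reasoning
    pointwise : ∀ x → ⟦ closer? v w x ⟧ + ⟦ closer? w v x ⟧ ≡ 1
    pointwise x with ⟦closer⟧ vw x
    ... | inj₁ (_ , e , e′) = cong₂ _+_ e e′
    ... | inj₂ (_ , e , e′) = cong₂ _+_ e e′

  -- Holds vertex by vertex: the farther end of the edge exceeds the nearer one by one, and the
  -- indicator on the other side makes up for it.
  status-branch : ∀ {v w} → Adj G v w → s v + branch w v ≡ s w + branch v w
  status-branch {v} {w} vw = begin
    s v + branch w v                       ≡⟨ cong (_+ branch w v) (status≡∑ v) ⟩
    ∑ (d v) + branch w v                   ≡⟨ ∑-distrib-+ (d v) _ ⟨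
    ∑ (λ x → d v x + ⟦ closer? w v x ⟧)    ≡⟨ sum-cong-≗ pointwise ⟩
    ∑ (λ x → d w x + ⟦ closer? v w x ⟧)    ≡⟨ ∑-distrib-+ (d w) _ ⟩
    ∑ (d w) + branch v w                   ≡⟨ cong (_+ branch v w) (status≡∑ w) ⟨
    s w + branch v w                       ∎
    where
    open ≡.≡-Reasoning
    pointwise : ∀ x → d v x + ⟦ closer? w v x ⟧ ≡ d w x + ⟦ closer? v w x ⟧
    pointwise x with ⟦closer⟧ vw x
    ... | inj₁ (e , e₁ , e₀) rewrite e₁ | e₀ | e = solve (d w x)
      where
      solve : ∀ a → suc a + 0 ≡ a + 1
      solve = solve-∀
    ... | inj₂ (e , e₀ , e₁) rewrite e₁ | e₀ | e = solve (d v x)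
      where
      solve : ∀ a → a + 1 ≡ suc a + 0
      solve = solve-∀

  status-edge : ∀ {v w} → Adj G v w → s w + (branch v w + branch v w) ≡ s v + n
  status-edge {v} {w} vw = begin
    s w + (branch v w + branch v w)  ≡⟨ +-assoc (s w) _ _ ⟨
    s w + branch v w + branch v w    ≡⟨ cong (_+ branch v w) (status-branch vw) ⟨
    s v + branch w v + branch v w    ≡⟨ +-assoc (s v) _ _ ⟩
    s v + (branch w v + branch v w)  ≡⟨ cong (s v +_) (≡.trans (+-comm (branch w v) _) (branch-complement vw)) ⟩
    s v + n                          ∎
    where open ≡.≡-Reasoning

  -- Each vertex other than `v` lies in exactly one branch; interchanging the sums counts the
  -- vertices instead of the branches.
  branch-partition : ∀ v → suc (∑ (branch v)) ≡ n
  branch-partition v = begin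
    1 + ∑ (branch v)                                    ≡⟨ cong₂ _+_ (≡.sym (∑-δ v)) (∑-comm {n} {n} (λ w x → ⟦ closer? v w x ⟧)) ⟩
    ∑ (λ x → ⟦ x ≟ v ⟧) + ∑ (λ x → ∑ λ w → ⟦ closer? v w x ⟧)  ≡⟨ ∑-distrib-+ (λ x → ⟦ x ≟ v ⟧) _ ⟨
    ∑ (λ x → ⟦ x ≟ v ⟧ + ∑ λ w → ⟦ closer? v w x ⟧)     ≡⟨ sum-cong-≗ pointwise ⟩
    ∑ {n} (λ _ → 1)                                     ≡⟨ ∑-one ⟩
    n                                                   ∎
    where
    open ≡.≡-Reasoning
    pointwise : ∀ x → ⟦ x ≟ v ⟧ + ∑ (λ w → ⟦ closer? v w x ⟧) ≡ 1
    pointwise x with x ≟ v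
    ... | yes refl = cong suc (≡.trans (sum-cong-≗ λ w → ⟦⟧-no (closer? x w x) λ (_ , e) →
      contradiction (≡.trans (≡.sym (dist-refl x)) e) λ ()) (∑-zero {n}))
    ... | no x≢v with closer-exists x≢v
    ...   | w , vwx = ∑-unique (λ w′ → closer? v w′ x) vwx (λ w′ vw′x → closer-unique vw′x vwx)

  branch-nonadjacent : ∀ {v w} → ¬ Adj G v w → branch v w ≡ 0
  branch-nonadjacent {v} {w} ¬vw = ≡.trans (sum-cong-≗ λ x → ⟦⟧-no (closer? v w x) (¬vw ∘ proj₁)) (∑-zero {n})

  -- Counting by kids and convexity of the status

  kid? : ∀ u v w → Dec (Adj G v w × w ≢ u)
  kid? u v w = Adj? G v w ×-dec ¬? (w ≟ u)

  -- u need not be a neighbour of v; in particular kids v v lists all neighbours of v.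
  kids : Fin n → Fin n → List (Fin n)
  kids u v = filter (kid? u v) (allFin n)

  kids⁺ : ∀ {u v w} → Adj G v w → w ≢ u → w ∈ kids u v
  kids⁺ {u} {v} vw w≢u = ∈-filter⁺ (kid? u v) (∈-allFin _) (vw , w≢u)

  kids⁻ : ∀ {u v w} → w ∈ kids u v → Adj G v w × w ≢ u
  kids⁻ {u} {v} = proj₂ ∘ ∈-filter⁻ (kid? u v) {xs = allFin n}

  kids! : ∀ u v → Unique (kids u v)
  kids! u v = filter⁺ (kid? u v) (allFin⁺ n)

  -- The summands are `v`, the branch towards `u`, and the branches of the kids. For `u` equal or
  -- not adjacent to `v` the middle one is 0, so one formula serves both kinds of median.
  order-by-kids : ∀ u v {t} → (∀ {w} → Adj G v w → w ≢ u → branch v w ≡ t) →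
                  n ≡ suc (branch v u + length (kids u v) * t)
  order-by-kids u v {t} equal = begin
    n                                                          ≡⟨ branch-partition v ⟨
    suc (∑ (branch v))                                         ≡⟨ cong suc (sum-cong-≗ pointwise) ⟩
    suc (∑ (λ w → ⟦ w ≟ u ⟧ * branch v u + ⟦ kid? u v w ⟧ * t))  ≡⟨ cong suc (∑-distrib-+ (λ w → ⟦ w ≟ u ⟧ * branch v u) _) ⟩
    suc (∑ (λ w → ⟦ w ≟ u ⟧ * branch v u) + ∑ (λ w → ⟦ kid? u v w ⟧ * t))
      ≡⟨ cong suc (cong₂ _+_ (*-distribʳ-sum (branch v u) (λ w → ⟦ w ≟ u ⟧)) (*-distribʳ-sum t (λ w → ⟦ kid? u v w ⟧))) ⟨
    suc (∑ (λ w → ⟦ w ≟ u ⟧) * branch v u + ∑ (λ w → ⟦ kid? u v w ⟧) * t)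
      ≡⟨ cong suc (cong₂ _+_ (≡.trans (cong (_* branch v u) (∑-δ u)) (*-identityˡ _))
                             (cong (_* t) (≡.sym (length-filter-tabulate (kid? u v) id)))) ⟩
    suc (branch v u + length (kids u v) * t)                   ∎
    where
    open ≡.≡-Reasoning
    pointwise : ∀ w → branch v w ≡ ⟦ w ≟ u ⟧ * branch v u + ⟦ kid? u v w ⟧ * t
    pointwise w = split (w ≟ u) (kid? u v w)
      where
      split : (w≟u : Dec (w ≡ u)) (kid : Dec (Adj G v w × w ≢ u)) →
              branch v w ≡ ⟦ w≟u ⟧ * branch v u + ⟦ kid ⟧ * t
      split (yes refl) (yes (_ , w≢u)) = contradiction refl w≢u
      split (yes refl) (no _)          = solve (branch v w)
        where
        solve : ∀ a → a ≡ a + 0 + 0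
        solve = solve-∀
      split (no _)   (yes (vw , w≢u)) = ≡.trans (equal vw w≢u) (≡.sym (*-identityˡ t))
      split (no w≢u) (no ¬kid)        = branch-nonadjacent λ vw → ¬kid (vw , w≢u)

  -- Distinct branches at `v` are disjoint, and neither contains `v`.
  two-branches : ∀ v {u w} → u ≢ w → suc (branch v u + branch v w) ≤ n
  two-branches v {u} {w} u≢w = begin
    1 + (branch v u + branch v w)
      ≡⟨ cong₂ _+_ (≡.sym (∑-δ v)) (≡.sym (∑-distrib-+ (λ x → ⟦ closer? v u x ⟧) _)) ⟩
    ∑ (λ x → ⟦ x ≟ v ⟧) + ∑ (λ x → ⟦ closer? v u x ⟧ + ⟦ closer? v w x ⟧)
      ≡⟨ ∑-distrib-+ (λ x → ⟦ x ≟ v ⟧) _ ⟨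
    ∑ (λ x → ⟦ x ≟ v ⟧ + (⟦ closer? v u x ⟧ + ⟦ closer? v w x ⟧))
      ≤⟨ ∑-mono pointwise ⟩
    ∑ {n} (λ _ → 1)
      ≡⟨ ∑-one ⟩
    n ∎
    where
    open ≤-Reasoning
    not-at : ∀ {w} → ¬ Closer v w v
    not-at (_ , e) = contradiction (≡.trans (≡.sym (dist-refl v)) e) λ ()
    pointwise : ∀ x → ⟦ x ≟ v ⟧ + (⟦ closer? v u x ⟧ + ⟦ closer? v w x ⟧) ≤ 1
    pointwise x = split (x ≟ v) (closer? v u x) (closer? v w x)
      where
      split : (x≟v : Dec (x ≡ v)) (u? : Dec (Closer v u x)) (w? : Dec (Closer v w x)) →
              ⟦ x≟v ⟧ + (⟦ u? ⟧ + ⟦ w? ⟧) ≤ 1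
      split (yes refl) (yes vux) _         = contradiction vux not-at
      split (yes refl) (no _)    (yes vwx) = contradiction vwx not-at
      split (yes refl) (no _)    (no _)    = ≤-refl
      split (no _)     (yes vux) (yes vwx) = contradiction (closer-unique vux vwx) u≢w
      split (no _)     (yes _)   (no _)    = ≤-refl
      split (no _)     (no _)    w?        = ⟦⟧≤1 w?

  -- Add `status-edge` for the two edges. The slack 2 is twice the vertex `v`, which is missing from
  -- both branches.
  status-convex : ∀ {u v w} → Adj G v u → Adj G v w → u ≢ w → s v + s v + 2 ≤ s u + s w
  status-convex {u} {v} {w} vu vw u≢w = +-cancelʳ-≤ (β + β) _ _ (begin
    s v + s v + 2 + (β + β)                  ≡⟨ solve₁ (s v) β ⟩
    s v + s v + (suc β + suc β)              ≤⟨ +-monoʳ-≤ (s v + s v) (+-mono-≤ β<n β<n) ⟩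
    s v + s v + (n + n)                      ≡⟨ solve₂ (s v) n ⟩
    (s v + n) + (s v + n)                    ≡⟨ cong₂ _+_ (status-edge vu) (status-edge vw) ⟨
    (s u + (branch v u + branch v u)) + (s w + (branch v w + branch v w))
                                             ≡⟨ solve₃ (s u) (s w) (branch v u) (branch v w) ⟩
    s u + s w + (β + β)                      ∎)
    where
    open ≤-Reasoning
    β = branch v u + branch v w
    β<n = two-branches v u≢w
    solve₁ : ∀ a b → a + a + 2 + (b + b) ≡ a + a + (suc b + suc b)
    solve₁ = solve-∀
    solve₂ : ∀ a b → a + a + (b + b) ≡ (a + b) + (a + b)
    solve₂ = solve-∀
    solve₃ : ∀ a b x y → (a + (x + x)) + (b + (y + y)) ≡ a + b + ((x + y) + (x + y))
    solve₃ = solve-∀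

  -- Once the status does not fall along an edge, it rises along every continuation that does not
  -- turn back.
  status-ascends : ∀ {u v w} → Adj G v u → Adj G v w → u ≢ w → s u ≤ s v → s v < s w
  status-ascends {u} {v} {w} vu vw u≢w su≤sv = +-cancelˡ-≤ (s v) _ _ (begin
    s v + suc (s v)       ≤⟨ +-monoʳ-≤ (s v) (n≤1+n _) ⟩
    s v + suc (suc (s v)) ≡⟨ solve (s v) ⟩
    s v + s v + 2         ≤⟨ status-convex vu vw u≢w ⟩
    s u + s w             ≤⟨ +-monoˡ-≤ (s w) su≤sv ⟩
    s v + s w             ∎)
    where
    open ≤-Reasoning
    solve : ∀ a → a + suc (suc a) ≡ a + a + 2
    solve = solve-∀

  branch-by-kids : ∀ {u v t} → Adj G u v → (∀ {w} → Adj G v w → w ≢ u → branch v w ≡ t) →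
                   branch u v ≡ suc (length (kids u v) * t)
  branch-by-kids {u} {v} {t} uv equal = +-cancelʳ-≡ (branch v u) _ _ (begin
    branch u v + branch v u                   ≡⟨ branch-complement uv ⟩
    n                                         ≡⟨ order-by-kids u v equal ⟩
    suc (branch v u + length (kids u v) * t)  ≡⟨ cong suc (+-comm (branch v u) _) ⟩
    suc (length (kids u v) * t) + branch v u  ∎)
    where open ≡.≡-Reasoning

  -- Adjacency of v and w is not part of this: w may be isolated.
  Leaf : Fin n → Fin n → Set
  Leaf v w = ∀ {x} → Adj G w x → x ≡ v

  branch-leaf : ∀ {v w} → Adj G v w → Leaf v w → branch v w ≡ 1
  branch-leaf {v} {w} vw leaf =
    -- No further kids exist, so the hypothesis on their branches is vacuous and `t` can be 0;
    -- emptiness of `kids v w` need not be shown.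
    ≡.trans (branch-by-kids vw (λ wx x≢v → contradiction (leaf wx) x≢v)) (cong suc (*-zeroʳ (length (kids v w))))

  status-leaf : ∀ {v w} → Adj G v w → Leaf v w → s w + 2 ≡ s v + n
  status-leaf {v} {w} vw leaf with status-edge vw
  ... | e rewrite branch-leaf vw leaf = e

  branch-of-leaves : ∀ {u v} → Adj G u v → (∀ {w} → Adj G v w → w ≢ u → Leaf v w) →
                     branch u v ≡ suc (length (kids u v))
  branch-of-leaves {u} {v} uv leaves =
    ≡.trans (branch-by-kids uv λ vw w≢u → branch-leaf vw (leaves vw w≢u)) (cong suc (*-identityʳ _))

  -- The index type `Fin b` is that of the constructors `l` and `p`: an enumeration is read off from
  -- a labelling in one direction and used to build one in the other.
  record KidEnumeration (u v : Fin n) (b : ℕ) : Set where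
    field
      kid        : Fin b → Fin n
      injective  : ∀ {i j} → kid i ≡ kid j → i ≡ j
      isKid      : ∀ i → Adj G v (kid i) × kid i ≢ u
      surjective : ∀ {w} → Adj G v w → w ≢ u → ∃ λ i → kid i ≡ w

  enumerateKids : ∀ u v {b} → length (kids u v) ≡ b → KidEnumeration u v b
  enumerateKids u v refl = record
    { kid        = lookup (kids u v)
    ; injective  = lookup-injective (kids! u v)
    ; isKid      = λ i → kids⁻ (∈-lookup i)
    ; surjective = λ vw w≢u → Any.index (kids⁺ vw w≢u) , ≡.sym (lookup-index (kids⁺ vw w≢u))
    }

  length-kids : ∀ {u v b} → KidEnumeration u v b → length (kids u v) ≡ b
  length-kids {u} {v} {b} E = ≤-antisym
    (subst (_ ≤_) (length-tabulate kid) (Unique-⊆⇒length≤ (kids! u v) λ w∈ →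
      let i , e = surjective (proj₁ (kids⁻ w∈)) (proj₂ (kids⁻ w∈)) in
      subst (_∈ tabulate kid) e (∈-tabulate⁺ i)))
    (subst (_≤ _) (length-tabulate kid) (Unique-⊆⇒length≤ (tabulate⁺ injective) λ w∈ →
      let i , e = ∈-tabulate⁻ w∈ in
      subst (_∈ kids u v) (≡.sym e) (kids⁺ (proj₁ (isKid i)) (proj₂ (isKid i)))))
    where open KidEnumeration E

  -- Seen from z, each neighbour other than u carries exactly b further vertices, all of them leaves.
  Broom : Fin n → Fin n → ℕ → Set
  Broom z u b = ∀ {v} → Adj G z v → v ≢ u →
    length (kids z v) ≡ b × (∀ {w} → Adj G v w → w ≢ z → Leaf v w)

  module _ {z u b} (broom : Broom z u b) {v} (zv : Adj G z v) (v≢u : v ≢ u) where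

    broom-branch : branch z v ≡ suc b
    broom-branch = ≡.trans (branch-of-leaves zv (proj₂ (broom zv v≢u))) (cong suc (proj₁ (broom zv v≢u)))

    broom-kid-status : s v + (suc b + suc b) ≡ s z + n
    broom-kid-status = subst (λ k → s v + (k + k) ≡ s z + n) broom-branch (status-edge zv)

    broom-grandkid-status : ∀ {w} → Adj G v w → w ≢ z → s w + 2 ≡ s v + n
    broom-grandkid-status vw w≢z = status-leaf vw (proj₂ (broom zv v≢u) vw w≢z)

  module _ {z u z′ u′ b} (broom : Broom z u b) (broom′ : Broom z′ u′ b) (sz≡sz′ : s z ≡ s z′)
           {v v′} (zv : Adj G z v) (v≢u : v ≢ u) (z′v′ : Adj G z′ v′) (v′≢u′ : v′ ≢ u′) where

    -- Both statuses equal s(z) + n - 2(b + 1), which depends only on the status of the centre and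
    -- on `b`.
    kid-statuses-agree : s v ≡ s v′
    kid-statuses-agree = +-cancelʳ-≡ (suc b + suc b) _ _
      (≡.trans (broom-kid-status broom zv v≢u)
        (≡.trans (cong (_+ n) sz≡sz′) (≡.sym (broom-kid-status broom′ z′v′ v′≢u′))))

    grandkid-statuses-agree : ∀ {w w′} → Adj G v w → w ≢ z → Adj G v′ w′ → w′ ≢ z′ → s w ≡ s w′
    grandkid-statuses-agree vw w≢z v′w′ w′≢z′ = +-cancelʳ-≡ 2 _ _
      (≡.trans (broom-grandkid-status broom zv v≢u vw w≢z)
        (≡.trans (cong (_+ n) kid-statuses-agree) (≡.sym (broom-grandkid-status broom′ z′v′ v′≢u′ v′w′ w′≢z′))))

  order-by-broom : ∀ {z u b} → Broom z u b → n ≡ suc (branch z u + length (kids u z) * suc b)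
  order-by-broom {z} {u} broom = order-by-kids u z (broom-branch broom)

  -- Members of the family have three statuses

  star⇒kG≡3 : ∀ {m b} → 2 ≤ m → 1 ≤ b → Labelling G (SV m b) SAdj → kG G ≡ 3
  star⇒kG≡3 {suc zero} (s≤s ())
  star⇒kG≡3 {suc (suc m)} {suc b} _ _ L =
    kG≡3 G {at c} {at (l zero)} {at (p zero zero)} centre<kid kid<grandkid covered
    where
    open Labelling L
    cl⁺ = λ i → adj⁺ (cl i)
    lp⁺ = λ i j → adj⁺ (lp i j)

    l≢c : ∀ i → at (l i) ≢ at c
    l≢c i e = contradiction (injective _ _ e) λ ()

    p≢c : ∀ i j → at (p i j) ≢ at c
    p≢c i j e = contradiction (injective _ _ e) λ ()

    leaf : ∀ i j → Leaf (at (l i)) (at (p i j))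
    leaf i j {x} px with surjective x
    ... | y , refl with y | adj⁻ _ y px
    ...   | _ | pl _ _ = refl

    enumeration : ∀ i → KidEnumeration (at c) (at (l i)) (suc b)
    enumeration i = record
      { kid        = at ∘ p i
      ; injective  = λ e → p-injective (injective _ _ e)
      ; isKid      = λ j → lp⁺ i j , p≢c i j
      ; surjective = exhaust
      }
      where
      p-injective : ∀ {j k} → p i j ≡ p i k → j ≡ k
      p-injective refl = refl
      exhaust : ∀ {w} → Adj G (at (l i)) w → w ≢ at c → ∃ λ j → at (p i j) ≡ w
      exhaust {w} lw w≢c with surjective w
      ... | y , refl with y | adj⁻ _ y lw
      ...   | _ | lc _   = contradiction refl w≢c
      ...   | _ | lp _ j = j , refl

    -- A single centre excludes itself, that is, no neighbour at all.
    broom : Broom (at c) (at c) (suc b)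
    broom {v} cv _ with surjective v
    ... | y , refl with y | adj⁻ _ y cv
    ...   | _ | cl i = length-kids (enumeration i) , λ lw w≢c →
      let j , e = KidEnumeration.surjective (enumeration i) lw w≢c in λ wx → leaf i j (subst (λ w → Adj G w _) (≡.sym e) wx)

    kid-status : ∀ i i′ → s (at (l i)) ≡ s (at (l i′))
    kid-status i i′ = kid-statuses-agree broom broom refl (cl⁺ i) (l≢c i) (cl⁺ i′) (l≢c i′)

    -- Two neighbours of equal status: by convexity the centre lies below them.
    centre<kid : s (at c) < s (at (l zero))
    centre<kid = ≰⇒> λ below → <⇒≱
      (status-ascends (cl⁺ zero) (cl⁺ (suc zero)) (λ e → contradiction (injective _ _ e) λ ()) below)
      (≤-trans (≤-reflexive (kid-status (suc zero) zero)) below)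

    kid<grandkid : s (at (l zero)) < s (at (p zero zero))
    kid<grandkid = status-ascends (adj⁺ (lc zero)) (lp⁺ zero zero) (p≢c zero zero ∘ ≡.sym) (<⇒≤ centre<kid)

    covered : ∀ x → s x ∈ s (at c) ∷ s (at (l zero)) ∷ s (at (p zero zero)) ∷ []
    covered x with surjective x
    ... | c , refl     = here refl
    ... | l i , refl   = there (here (kid-status i zero))
    ... | p i j , refl = there (there (here (grandkid-statuses-agree broom broom refl
      (cl⁺ i) (l≢c i) (cl⁺ zero) (l≢c zero) (lp⁺ i j) (p≢c i j) (lp⁺ zero zero) (p≢c zero zero))))

  doubleStar⇒kG≡3 : ∀ {a b} → 1 ≤ a → 1 ≤ b → Labelling G (DV a b) DAdj → kG G ≡ 3
  doubleStar⇒kG≡3 {suc a} {suc b} _ _ L =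
    kG≡3 G {at (c zero)} {at (l zero zero)} {at (p zero zero zero)} centre<kid kid<grandkid covered
    where
    open Labelling L
    cl⁺ = λ t i → adj⁺ (cl t i)
    lp⁺ = λ t i j → adj⁺ (lp t i j)

    l≢c : ∀ t i t′ → at (l t i) ≢ at (c t′)
    l≢c t i t′ e = contradiction (injective _ _ e) λ ()

    p≢c : ∀ t i j t′ → at (p t i j) ≢ at (c t′)
    p≢c t i j t′ e = contradiction (injective _ _ e) λ ()

    leaf : ∀ t i j → Leaf (at (l t i)) (at (p t i j))
    leaf t i j {x} px with surjective x
    ... | y , refl with y | adj⁻ _ y px
    ...   | _ | pl _ _ _ = refl

    kidsOfKid : ∀ t i → KidEnumeration (at (c t)) (at (l t i)) (suc b)
    kidsOfKid t i = record
      { kid        = at ∘ p t i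
      ; injective  = λ e → p-injective (injective _ _ e)
      ; isKid      = λ j → lp⁺ t i j , p≢c t i j t
      ; surjective = exhaust
      }
      where
      p-injective : ∀ {j k} → p t i j ≡ p t i k → j ≡ k
      p-injective refl = refl
      exhaust : ∀ {w} → Adj G (at (l t i)) w → w ≢ at (c t) → ∃ λ j → at (p t i j) ≡ w
      exhaust {w} lw w≢c with surjective w
      ... | y , refl with y | adj⁻ _ y lw
      ...   | _ | lc _ _   = contradiction refl w≢c
      ...   | _ | lp _ _ j = j , refl

    kidsOfCentre : ∀ {t t′} → t ≢ t′ → KidEnumeration (at (c t′)) (at (c t)) (suc a)
    kidsOfCentre {t} {t′} t≢t′ = record
      { kid        = at ∘ l t
      ; injective  = λ e → l-injective (injective _ _ e)
      ; isKid      = λ i → cl⁺ t i , l≢c t i t′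
      ; surjective = exhaust
      }
      where
      l-injective : ∀ {j k} → l t j ≡ l t k → j ≡ k
      l-injective refl = refl
      exhaust : ∀ {w} → Adj G (at (c t)) w → w ≢ at (c t′) → ∃ λ j → at (l t j) ≡ w
      exhaust {w} cw w≢c with surjective w
      ... | y , refl with y | adj⁻ _ y cw
      ...   | _ | cl _ i       = i , refl
      ...   | _ | cc _ t″ t≢t″ = contradiction (cong (at ∘ c) (third t≢t″ t≢t′)) w≢c
        where
        third : ∀ {i j k : Fin 2} → i ≢ j → i ≢ k → j ≡ k
        third {zero}     {zero}     i≢j _   = contradiction refl i≢j
        third {zero}     {suc zero} {zero}     _ i≢k = contradiction refl i≢k
        third {zero}     {suc zero} {suc zero} _ _   = refl
        third {suc zero} {suc zero} i≢j _   = contradiction refl i≢j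
        third {suc zero} {zero}     {suc zero} _ i≢k = contradiction refl i≢k
        third {suc zero} {zero}     {zero}     _ _   = refl

    broom : ∀ {t t′} → t ≢ t′ → Broom (at (c t)) (at (c t′)) (suc b)
    broom {t} t≢t′ {v} cv v≢c with KidEnumeration.surjective (kidsOfCentre t≢t′) cv v≢c
    ... | i , refl = length-kids (kidsOfKid t i) , λ lw w≢c →
      let j , e = KidEnumeration.surjective (kidsOfKid t i) lw w≢c in λ wx → leaf t i j (subst (λ w → Adj G w _) (≡.sym e) wx)

    broomAt : ∀ t → ∃ λ u → Broom (at (c t)) u (suc b) × ∀ i → at (l t i) ≢ u
    broomAt zero       = at (c (suc zero)) , broom (λ ()) , λ i → l≢c zero i (suc zero)
    broomAt (suc zero) = at (c zero) , broom (λ ()) , λ i → l≢c (suc zero) i zero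

    c₀c₁ : Adj G (at (c zero)) (at (c (suc zero)))
    c₀c₁ = adj⁺ (cc _ _ λ ())

    branch-size : ∀ {t t′} → t ≢ t′ → n ≡ suc (branch (at (c t)) (at (c t′)) + suc a * suc (suc b))
    branch-size {t} {t′} t≢t′ = subst (λ k → n ≡ suc (branch (at (c t)) (at (c t′)) + k * suc (suc b)))
      (length-kids (kidsOfCentre t≢t′)) (order-by-broom (broom t≢t′))

    -- Both centres see equally many kids with branches of equal size, so the rest of `n`, the
    -- opposite half, is equal too.
    balanced : branch (at (c zero)) (at (c (suc zero))) ≡ branch (at (c (suc zero))) (at (c zero))
    balanced = +-cancelʳ-≡ (suc a * suc (suc b)) _ _
      (suc-injective (≡.trans (≡.sym (branch-size {zero} {suc zero} λ ())) (branch-size {suc zero} {zero} λ ())))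

    centre-statuses : s (at (c (suc zero))) ≡ s (at (c zero))
    centre-statuses = +-cancelʳ-≡ (branch (at (c zero)) (at (c (suc zero)))) _ _
      (≡.trans (≡.sym (status-branch c₀c₁)) (cong (s (at (c zero)) +_) (≡.sym balanced)))

    centre-status : ∀ t → s (at (c t)) ≡ s (at (c zero))
    centre-status zero       = refl
    centre-status (suc zero) = centre-statuses

    -- The edge between the centres is level, so by convexity the status rises beyond it.
    centre<kid : s (at (c zero)) < s (at (l zero zero))
    centre<kid = status-ascends c₀c₁ (cl⁺ zero zero) (l≢c zero zero (suc zero) ∘ ≡.sym) (≤-reflexive centre-statuses)

    kid<grandkid : s (at (l zero zero)) < s (at (p zero zero zero))
    kid<grandkid = status-ascends (adj⁺ (lc zero zero)) (lp⁺ zero zero zero) (p≢c zero zero zero zero ∘ ≡.sym) (<⇒≤ centre<kid)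

    covered : ∀ x → s x ∈ s (at (c zero)) ∷ s (at (l zero zero)) ∷ s (at (p zero zero zero)) ∷ []
    covered x with surjective x
    ... | c t , refl = here (centre-status t)
    ... | l t i , refl = let _ , B , l≢ = broomAt t ; _ , B₀ , l≢₀ = broomAt zero in
      there (here (kid-statuses-agree B B₀ (centre-status t) (cl⁺ t i) (l≢ i) (cl⁺ zero zero) (l≢₀ zero)))
    ... | p t i j , refl = let _ , B , l≢ = broomAt t ; _ , B₀ , l≢₀ = broomAt zero in
      there (there (here (grandkid-statuses-agree B B₀ (centre-status t) (cl⁺ t i) (l≢ i) (cl⁺ zero zero) (l≢₀ zero)
        (lp⁺ t i j) (p≢c t i j t) (lp⁺ zero zero zero) (p≢c zero zero zero zero))))

  -- The median

  -- The vertices of minimum status: a single vertex (z₀ = z₁) or two adjacent ones.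
  record Median (z₀ z₁ : Fin n) : Set where
    field
      joined : z₁ ≡ z₀ ⊎ Adj G z₀ z₁
      equal  : s z₁ ≡ s z₀
      above₀ : ∀ {v} → Adj G z₀ v → v ≢ z₁ → s z₀ < s v
      above₁ : ∀ {v} → Adj G z₁ v → v ≢ z₀ → s z₀ < s v

  -- A neighbour tied with the minimum makes their edge level, and convexity lifts all other
  -- neighbours of both ends. If none is tied, minimality is already strict.
  median : ∀ z₀ → (∀ v → s z₀ ≤ s v) → ∃ λ z₁ → Median z₀ z₁
  median z₀ minimal with any? (λ v → Adj? G z₀ v ×-dec (s v ℕ.≟ s z₀))
  ... | yes (z₁ , z₀z₁ , e) = z₁ , record
    { joined  = inj₂ z₀z₁
    ; equal   = e
    ; above₀  = λ z₀v v≢z₁ → status-ascends z₀z₁ z₀v (v≢z₁ ∘ ≡.sym) (≤-reflexive e)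
    ; above₁  = λ z₁v v≢z₀ → subst (_< _) e
        (status-ascends (Adj-sym G z₀z₁) z₁v (v≢z₀ ∘ ≡.sym) (≤-reflexive (≡.sym e)))
    }
  ... | no none = z₀ , record
    { joined  = inj₁ refl
    ; equal   = refl
    ; above₀  = λ z₀v _ → strict z₀v
    ; above₁  = λ z₀v _ → strict z₀v
    }
    where
    strict : ∀ {v} → Adj G z₀ v → s z₀ < s v
    strict z₀v = ≤∧≢⇒< (minimal _) λ e → none (_ , z₀v , ≡.sym e)

  -- A positive number of values excludes the graph without vertices, which is vacuously a tree.
  least-status : 1 ≤ kG G → ∃ λ z → ∀ v → s z ≤ s v
  least-status = pick (allFin n) refl
    where
    pick : ∀ vs → vs ≡ allFin n → 1 ≤ length (deduplicate ℕ._≟_ (map s vs)) → ∃ λ z → ∀ v → s z ≤ s v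
    pick (u ∷ vs) all _ = Extrema.argmin s u vs , λ v → bound (subst (v ∈_) (≡.sym all) (∈-allFin v))
      where
      bound : ∀ {v} → v ∈ u ∷ vs → s (Extrema.argmin s u vs) ≤ s v
      bound (here refl) = Extrema.f[argmin]≤f[⊤] {f = s} u vs
      bound (there v∈)  = All.lookup (Extrema.f[argmin]≤f[xs] {f = s} u vs) v∈

  -- Shape of a tree with three statuses

  module FromMedian (kG≡3 : kG G ≡ 3) {z₀ z₁} (med : Median z₀ z₁) where
    open Median med

    -- The second index is the vertex not to be counted as a kid. For a single median both
    -- constructors describe the same pair.
    data Centre : Fin n → Fin n → Set where
      first  : Centre z₀ z₁
      second : Centre z₁ z₀

    swap : ∀ {z z′} → Centre z z′ → Centre z′ z
    swap first  = second
    swap second = first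

    centre-status : ∀ {z z′} → Centre z z′ → s z ≡ s z₀
    centre-status first  = refl
    centre-status second = equal

    record Kid (z z′ v : Fin n) : Set where
      constructor mkKid
      field
        centre : Centre z z′
        edge   : Adj G z v
        other  : v ≢ z′

      below : s z < s v
      below with centre
      ... | first  = above₀ edge other
      ... | second = subst (_< s v) (≡.sym equal) (above₁ edge other)

    record Grandkid (z z′ v w : Fin n) : Set where
      constructor mkGrandkid
      field
        kid   : Kid z z′ v
        edge  : Adj G v w
        other : w ≢ z

      below : s v < s w
      below = status-ascends (Adj-sym G (Kid.edge kid)) edge (other ∘ ≡.sym) (<⇒≤ (Kid.below kid))

    no-four : ∀ {t u v w} → s t < s u → s u < s v → s v < s w → ⊥
    no-four {t} {u} {v} {w} t<u u<v v<w = <-irrefl (≡.sym kG≡3)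
      (length≤kG G (t ∷ u ∷ v ∷ w ∷ []) (t<u ∷ u<v ∷ v<w ∷ [-]))

    -- A further neighbour would be the fourth vertex of a chain with rising statuses.
    grandkid-leaf : ∀ {z z′ v w} → Grandkid z z′ v w → Leaf v w
    grandkid-leaf {v = v} g {x} wx with x ≟ v
    ... | yes x≡v = x≡v
    ... | no x≢v  = ⊥-elim (no-four (Kid.below kid) below
      (status-ascends (Adj-sym G edge) wx (x≢v ∘ ≡.sym) (<⇒≤ below)))
      where open Grandkid g

    data Place (x : Fin n) : Set where
      isCentre   : ∀ {z′} → Centre x z′ → Place x
      isKid      : ∀ {z z′} → Kid z z′ x → Place x
      isGrandkid : ∀ {z z′ v} → Grandkid z z′ v x → Place x

    place-step : ∀ {x y} → Place x → Adj G x y → Place y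
    place-step {y = y} (isCentre {z′} cen) xy with y ≟ z′
    ... | yes refl = isCentre (swap cen)
    ... | no y≢z′  = isKid (mkKid cen xy y≢z′)
    place-step {y = y} (isKid {z} k) xy with y ≟ z
    ... | yes refl = isCentre (Kid.centre k)
    ... | no y≢z   = isGrandkid (mkGrandkid k xy y≢z)
    place-step (isGrandkid g) xy with grandkid-leaf g xy
    ... | refl = isKid (Grandkid.kid g)

    place : ∀ x → Place x
    place x = along (isCentre first) (proj₁ tree z₀ x)
      where
      along : ∀ {u v} → Place u → Walk G u v → Place v
      along pl-u here          = pl-u
      along pl-u (step uw w-v) = along (place-step pl-u uw) w-v

    barren-kid : ∀ {z z′ v} → Kid z z′ v → Leaf z v → s v + 2 ≡ s z₀ + n
    barren-kid k leaf = ≡.trans (status-leaf (Kid.edge k) leaf) (cong (_+ n) (centre-status (Kid.centre k)))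

    grandkid-or-leaf : ∀ {z z′ v} → Kid z z′ v → (∃ λ w → Grandkid z z′ v w) ⊎ Leaf z v
    grandkid-or-leaf {z} {v = v} k with any? (kid? z v)
    ... | yes (w , vw , w≢z) = inj₁ (w , mkGrandkid k vw w≢z)
    ... | no none = inj₂ λ {x} vx → decidable-stable (x ≟ z) λ x≢z → none (x , vx , x≢z)

    -- Without grandkids every vertex is a centre or a leaf at one, which leaves only the values
    -- s(z₀) and s(z₀) + n - 2. The truncated subtraction is harmless, being applied only where s(v)
    -- + 2 = s(z₀) + n.
    some-grandkid : ∃ λ z → ∃ λ z′ → ∃ λ v → ∃ λ w → Grandkid z z′ v w
    some-grandkid with any? (λ v → ¬? (s v ℕ.≟ s z₀) ×-dec ¬? (s v + 2 ℕ.≟ s z₀ + n))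
    ... | no none = contradiction (≤-trans (≤-reflexive (≡.sym kG≡3)) (kG≤length G {s z₀ ∷ s z₀ + n ∸ 2 ∷ []} two)) λ { (s≤s (s≤s ())) }
      where
      two : ∀ v → s v ∈ s z₀ ∷ s z₀ + n ∸ 2 ∷ []
      two v with s v ℕ.≟ s z₀ | s v + 2 ℕ.≟ s z₀ + n
      ... | yes e | _     = here e
      ... | no _  | yes e = there (here (≡.trans (≡.sym (m+n∸n≡m (s v) 2)) (cong (_∸ 2) e)))
      ... | no e₁ | no e₂ = contradiction (v , e₁ , e₂) none
    ... | yes (v , e₁ , e₂) with place v
    ...   | isCentre cen = contradiction (centre-status cen) e₁
    ...   | isGrandkid g = _ , _ , _ , _ , g
    ...   | isKid k with grandkid-or-leaf k
    ...     | inj₁ (_ , g) = _ , _ , _ , _ , g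
    ...     | inj₂ leaf    = contradiction (barren-kid k leaf) e₂

    -- A kid without kids would have a status strictly between those of a fertile kid and its grandkid.
    fertile : ∀ {z z′ v y y′ x w} → Kid z z′ v → Grandkid y y′ x w → ∃ λ w′ → Grandkid z z′ v w′
    fertile {z} {v = v} {y} {x = x} {w} k g with grandkid-or-leaf k
    ... | inj₁ found = found
    ... | inj₂ leaf  = ⊥-elim (no-four (Kid.below kid) x<v v<w)
      where
      open Grandkid g
      open ≤-Reasoning
      -- This branch contains `x` and the leaf `w`; that of the barren kid contains `v` alone.
      2≤branch : 2 ≤ branch y x
      2≤branch = +-cancelʳ-≤ (branch x y) _ _ (begin
        2 + branch x y             ≡⟨ cong suc (+-comm 1 (branch x y)) ⟩
        suc (branch x y + 1)       ≡⟨ cong (λ t → suc (branch x y + t)) (branch-leaf edge (grandkid-leaf g)) ⟨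
        suc (branch x y + branch x w)  ≤⟨ two-branches x (other ∘ ≡.sym) ⟩
        n                          ≡⟨ branch-complement (Kid.edge kid) ⟨
        branch y x + branch x y    ∎)
      x<v : s x < s v
      x<v = +-cancelʳ-≤ 2 _ _ (begin
        suc (s x) + 2              ≤⟨ n≤1+n _ ⟩
        2 + (s x + 2)              ≡⟨ solve (s x) ⟩
        s x + (2 + 2)              ≤⟨ +-monoʳ-≤ (s x) (+-mono-≤ 2≤branch 2≤branch) ⟩
        s x + (branch y x + branch y x)  ≡⟨ status-edge (Kid.edge kid) ⟩
        s y + n                    ≡⟨ cong (_+ n) (centre-status (Kid.centre kid)) ⟩
        s z₀ + n                   ≡⟨ barren-kid k leaf ⟨
        s v + 2                    ∎)
        where
        solve : ∀ a → 2 + (a + 2) ≡ a + (2 + 2)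
        solve = solve-∀
      -- Both are leaves, each n - 2 above its neighbour, and the neighbour `x` of `w` lies above
      -- the centre.
      v<w : s v < s w
      v<w = +-cancelʳ-≤ 2 _ _ (begin
        suc (s v) + 2              ≡⟨ cong suc (barren-kid k leaf) ⟩
        suc (s z₀) + n             ≡⟨ cong (λ t → suc t + n) (centre-status (Kid.centre kid)) ⟨
        suc (s y) + n              ≤⟨ +-monoˡ-≤ n (Kid.below kid) ⟩
        s x + n                    ≡⟨ status-leaf edge (grandkid-leaf g) ⟨
        s w + 2                    ∎)

    -- Otherwise a centre, the lower kid, the higher kid and a grandkid below the latter have four
    -- statuses.
    fertile-kids-agree : ∀ {z z′ v w y y′ x t} → Grandkid z z′ v w → Grandkid y y′ x t → s v ≡ s x
    fertile-kids-agree {v = v} {x = x} g h with <-cmp (s v) (s x)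
    ... | tri< v<x _ _ = ⊥-elim (no-four (Kid.below (Grandkid.kid g)) v<x (Grandkid.below h))
    ... | tri≈ _ e _   = e
    ... | tri> _ _ x<v = ⊥-elim (no-four (Kid.below (Grandkid.kid h)) x<v (Grandkid.below g))

    -- By `status-edge`, equal statuses of kids and of centres force equal branches, and a branch
    -- consists of the kid and its leaves.
    kid-counts-agree : ∀ {z z′ v w y y′ x t} → Grandkid z z′ v w → Grandkid y y′ x t →
                       length (kids z v) ≡ length (kids y x)
    kid-counts-agree {z} {v = v} {y = y} {x = x} g h =
      suc-injective (≡.trans (≡.sym (size g)) (≡.trans (double (branch z v) (branch y x) doubled) (size h)))
      where
      module K = Kid (Grandkid.kid g)
      module K′ = Kid (Grandkid.kid h)
      size : ∀ {z z′ v w} → Grandkid z z′ v w → branch z v ≡ suc (length (kids z v))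
      size e = branch-of-leaves (Kid.edge (Grandkid.kid e))
        λ vw w≢z → grandkid-leaf (mkGrandkid (Grandkid.kid e) vw w≢z)
      doubled : branch z v + branch z v ≡ branch y x + branch y x
      doubled = +-cancelˡ-≡ (s v) _ _ (begin
        s v + (branch z v + branch z v)  ≡⟨ status-edge K.edge ⟩
        s z + n                          ≡⟨ cong (_+ n) (≡.trans (centre-status K.centre) (≡.sym (centre-status K′.centre))) ⟩
        s y + n                          ≡⟨ status-edge K′.edge ⟨
        s x + (branch y x + branch y x)  ≡⟨ cong (_+ _) (fertile-kids-agree g h) ⟨
        s v + (branch y x + branch y x)  ∎)
        where open ≡.≡-Reasoning
      double : ∀ i j → i + i ≡ j + j → i ≡ j
      double i j e with <-cmp i j
      ... | tri< i<j _ _ = contradiction e (<⇒≢ (+-mono-< i<j i<j))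
      ... | tri≈ _ i≡j _ = i≡j
      ... | tri> _ _ j<i = contradiction (≡.sym e) (<⇒≢ (+-mono-< j<i j<i))

    brooms : ∃ λ b → 1 ≤ b × ∀ {z z′} → Centre z z′ → Broom z z′ b
    brooms with some-grandkid
    ... | z , _ , v , w , g = length (kids z v) , ∈-length (kids⁺ (Grandkid.edge g) (Grandkid.other g)) ,
      λ cen zv v≢z′ → let k = mkKid cen zv v≢z′ in
        kid-counts-agree (proj₂ (fertile k g)) g , λ vw w≢z → grandkid-leaf (mkGrandkid k vw w≢z)

    -- Disjointness and non-adjacency of the levels

    centre≢kid : ∀ {z z′ y y′ v} → Centre z z′ → Kid y y′ v → z ≢ v
    centre≢kid cen k refl =
      <-irrefl (≡.trans (centre-status (Kid.centre k)) (≡.sym (centre-status cen))) (Kid.below k)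

    centre≁grandkid : ∀ {z z′ y y′ v w} → Centre z z′ → Grandkid y y′ v w → ¬ Adj G z w
    centre≁grandkid cen g zw = centre≢kid cen (Grandkid.kid g) (grandkid-leaf g (Adj-sym G zw))

    kid≢grandkid : ∀ {z z′ v y y′ x w} → Kid z z′ v → Grandkid y y′ x w → v ≢ w
    kid≢grandkid k g refl = centre≁grandkid (Kid.centre k) g (Kid.edge k)

    centre≢grandkid : ∀ {z z′ y y′ x w} → Centre z z′ → Grandkid y y′ x w → z ≢ w
    centre≢grandkid cen g refl =
      <-irrefl (≡.trans (centre-status (Kid.centre kid)) (≡.sym (centre-status cen))) (<-trans (Kid.below kid) below)
      where open Grandkid g

    -- A kid adjacent to two distinct centres would lie strictly above both, against convexity.
    kid-parent : ∀ {z z′ y y′ v} → Kid y y′ v → Centre z z′ → Adj G z v → z ≡ y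
    kid-parent {z} {y = y} k cen zv = decidable-stable (z ≟ y) λ z≢y →
      <-asym (Kid.below k) (status-ascends (Adj-sym G zv) (Adj-sym G (Kid.edge k)) z≢y
        (≤-trans (≤-reflexive (≡.trans (centre-status cen) (≡.sym (centre-status (Kid.centre k))))) (<⇒≤ (Kid.below k))))

    kid≁kid : ∀ {z z′ v y y′ x} → Kid z z′ v → Kid y y′ x → ¬ Adj G v x
    kid≁kid k h vx = kid≢grandkid h (mkGrandkid k vx (centre≢kid (Kid.centre k) h ∘ ≡.sym)) refl

    grandkid≁grandkid : ∀ {z z′ v w y y′ x t} → Grandkid z z′ v w → Grandkid y y′ x t → ¬ Adj G w t
    grandkid≁grandkid g h wt = kid≢grandkid (Grandkid.kid g) h (≡.sym (grandkid-leaf g wt))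

    -- Labelling the tree by a model

    -- `m` is kept apart from the length of the list so that both halves of a double star can share
    -- one index type.
    module Labels {b} (broom : ∀ {z z′} → Centre z z′ → Broom z z′ b) {z z′} (cen : Centre z z′)
                  {m} (m-kids : length (kids z′ z) ≡ m) where

      module Kids = KidEnumeration (enumerateKids z′ z m-kids)

      kid : Fin m → Fin n
      kid = Kids.kid

      kid-isKid : ∀ i → Kid z z′ (kid i)
      kid-isKid i = mkKid cen (proj₁ (Kids.isKid i)) (proj₂ (Kids.isKid i))

      module Grandkids (i : Fin m) = KidEnumeration
        (enumerateKids z (kid i) (proj₁ (broom cen (proj₁ (Kids.isKid i)) (proj₂ (Kids.isKid i)))))

      grandkid : Fin m → Fin b → Fin n
      grandkid i = Grandkids.kid i

      grandkid-isGrandkid : ∀ i j → Grandkid z z′ (kid i) (grandkid i j)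
      grandkid-isGrandkid i j = mkGrandkid (kid-isKid i) (proj₁ (Grandkids.isKid i j)) (proj₂ (Grandkids.isKid i j))

    single-centre : z₁ ≡ z₀ → ∀ {z z′} → Centre z z′ → z ≡ z₀ × z′ ≡ z₁
    single-centre _     first  = refl , refl
    single-centre z₁≡z₀ second = z₁≡z₀ , ≡.sym z₁≡z₀

    module Star {b} (broom : ∀ {z z′} → Centre z z′ → Broom z z′ b) (z₁≡z₀ : z₁ ≡ z₀) where

      open Labels broom first refl

      at : SV (length (kids z₁ z₀)) b → Fin n
      at c       = z₀
      at (l i)   = kid i
      at (p i j) = grandkid i j

      adj⁺ : ∀ {x y} → SAdj x y → Adj G (at x) (at y)
      adj⁺ (cl i)   = Kid.edge (kid-isKid i)
      adj⁺ (lc i)   = Adj-sym G (Kid.edge (kid-isKid i))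
      adj⁺ (lp i j) = Grandkid.edge (grandkid-isGrandkid i j)
      adj⁺ (pl i j) = Adj-sym G (Grandkid.edge (grandkid-isGrandkid i j))

      adj⁻ : ∀ x y → Adj G (at x) (at y) → SAdj x y
      adj⁻ c        c        e = contradiction e (Adj-irrefl G)
      adj⁻ c        (l i)    _ = cl i
      adj⁻ c        (p i j)  e = contradiction e (centre≁grandkid first (grandkid-isGrandkid i j))
      adj⁻ (l i)    c        _ = lc i
      adj⁻ (l i)    (l i′)   e = contradiction e (kid≁kid (kid-isKid i) (kid-isKid i′))
      adj⁻ (l i)    (p i′ j) e with Kids.injective (grandkid-leaf (grandkid-isGrandkid i′ j) (Adj-sym G e))
      ... | refl = lp i j
      adj⁻ (p i j)  c        e = contradiction (Adj-sym G e) (centre≁grandkid first (grandkid-isGrandkid i j))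
      adj⁻ (p i j)  (l i′)   e with Kids.injective (grandkid-leaf (grandkid-isGrandkid i j) e)
      ... | refl = pl i j
      adj⁻ (p i j) (p i′ j′) e = contradiction e (grandkid≁grandkid (grandkid-isGrandkid i j) (grandkid-isGrandkid i′ j′))

      injective : ∀ x y → at x ≡ at y → x ≡ y
      injective c       c         _ = refl
      injective c       (l i)     e = contradiction e (centre≢kid first (kid-isKid i))
      injective c       (p i j)   e = contradiction e (centre≢grandkid first (grandkid-isGrandkid i j))
      injective (l i)   c         e = contradiction (≡.sym e) (centre≢kid first (kid-isKid i))
      injective (l i)   (l i′)    e = cong l (Kids.injective e)
      injective (l i)   (p i′ j)  e = contradiction e (kid≢grandkid (kid-isKid i) (grandkid-isGrandkid i′ j))
      injective (p i j) c         e = contradiction (≡.sym e) (centre≢grandkid first (grandkid-isGrandkid i j))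
      injective (p i j) (l i′)    e = contradiction (≡.sym e) (kid≢grandkid (kid-isKid i′) (grandkid-isGrandkid i j))
      -- A shared grandkid is adjacent to kid `i`, and a leaf has one neighbour, so `i′` is `i`.
      injective (p i j) (p i′ j′) e with adj⁻ (l i) (p i′ j′) (subst (Adj G (kid i)) e (adj⁺ (lp i j)))
      ... | lp _ _ = cong (p i) (Grandkids.injective i e)

      surjective : ∀ x → ∃ λ y → at y ≡ x
      surjective x with place x
      ... | isCentre cen = c , ≡.sym (proj₁ (single-centre z₁≡z₀ cen))
      ... | isKid (mkKid cen zx x≢z′) with single-centre z₁≡z₀ cen
      ...   | refl , refl with Kids.surjective zx x≢z′
      ...     | i , e = l i , e
      surjective x | isGrandkid (mkGrandkid (mkKid cen zv v≢z′) vx x≢z) with single-centre z₁≡z₀ cen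
      ... | refl , refl with Kids.surjective zv v≢z′
      ...   | i , refl with Grandkids.surjective i vx x≢z
      ...     | j , e = p i j , e

      labelling : Labelling G (SV (length (kids z₁ z₀)) b) SAdj
      labelling = record
        { at = at ; injective = injective ; surjective = surjective ; adj⁺ = adj⁺ ; adj⁻ = adj⁻ }

    module DoubleStar {b a} (broom : ∀ {z z′} → Centre z z′ → Broom z z′ b) (z₀z₁ : Adj G z₀ z₁)
                      (a₀ : length (kids z₁ z₀) ≡ a) (a₁ : length (kids z₀ z₁) ≡ a) where

      centre : Fin 2 → Fin n
      centre zero       = z₀
      centre (suc zero) = z₁

      other : Fin 2 → Fin n
      other zero       = z₁
      other (suc zero) = z₀

      isC : ∀ t → Centre (centre t) (other t)
      isC zero       = first
      isC (suc zero) = second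

      kids-of : ∀ t → length (kids (other t) (centre t)) ≡ a
      kids-of zero       = a₀
      kids-of (suc zero) = a₁

      module L (t : Fin 2) = Labels broom (isC t) (kids-of t)

      at : DV a b → Fin n
      at (c t)     = centre t
      at (l t i)   = L.kid t i
      at (p t i j) = L.grandkid t i j

      centre-adj : ∀ {t t′} → t ≢ t′ → Adj G (centre t) (centre t′)
      centre-adj {zero}     {zero}     t≢t = contradiction refl t≢t
      centre-adj {zero}     {suc zero} _   = z₀z₁
      centre-adj {suc zero} {zero}     _   = Adj-sym G z₀z₁
      centre-adj {suc zero} {suc zero} t≢t = contradiction refl t≢t

      centre-injective : ∀ {t t′} → centre t ≡ centre t′ → t ≡ t′
      centre-injective {t} {t′} e = decidable-stable (t ≟ t′) λ t≢t′ →
        Adj-irrefl G (subst (Adj G (centre t)) (≡.sym e) (centre-adj t≢t′))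

      cl⁺ : ∀ t i → Adj G (centre t) (L.kid t i)
      cl⁺ t i = Kid.edge (L.kid-isKid t i)

      lp⁺ : ∀ t i j → Adj G (L.kid t i) (L.grandkid t i j)
      lp⁺ t i j = Grandkid.edge (L.grandkid-isGrandkid t i j)

      adj⁺ : ∀ {x y} → DAdj x y → Adj G (at x) (at y)
      adj⁺ (cc _ _ t≢t′) = centre-adj t≢t′
      adj⁺ (cl t i)      = cl⁺ t i
      adj⁺ (lc t i)      = Adj-sym G (cl⁺ t i)
      adj⁺ (lp t i j)    = lp⁺ t i j
      adj⁺ (pl t i j)    = Adj-sym G (lp⁺ t i j)

      kid-centre : ∀ {t t′ i} → Adj G (centre t) (L.kid t′ i) → t ≡ t′
      kid-centre {t} {t′} {i} e = centre-injective (kid-parent (L.kid-isKid t′ i) (isC t) e)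

      -- First the centres agree, then the positions among the kids of that centre; equality of
      -- labels records both.
      kid-injective : ∀ t i t′ i′ → L.kid t i ≡ L.kid t′ i′ → l {b = b} t i ≡ l t′ i′
      kid-injective t i t′ i′ e = go (kid-centre {t} {t′} {i′} (subst (Adj G (centre t)) e (cl⁺ t i))) e
        where
        go : ∀ {t′ i′} → t ≡ t′ → L.kid t i ≡ L.kid t′ i′ → l {b = b} t i ≡ l t′ i′
        go refl e = cong (l t) (L.Kids.injective t e)

      grandkid-parent : ∀ t i t′ i′ j → Adj G (L.kid t i) (L.grandkid t′ i′ j) → l {b = b} t i ≡ l t′ i′
      grandkid-parent t i t′ i′ j e =
        kid-injective t i t′ i′ (grandkid-leaf (L.grandkid-isGrandkid t′ i′ j) (Adj-sym G e))

      lp≡ : ∀ {t i t′ i′ j} → l {b = b} t i ≡ l t′ i′ → DAdj {a} {b} (l t i) (p t′ i′ j)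
      lp≡ refl = lp _ _ _

      pl≡ : ∀ {t i t′ i′ j} → l {b = b} t′ i′ ≡ l t i → DAdj {a} {b} (p t i j) (l t′ i′)
      pl≡ refl = pl _ _ _

      siblings : ∀ {t i t′ i′ j j′} → l {b = b} t i ≡ l t′ i′ → L.grandkid t i j ≡ L.grandkid t′ i′ j′ →
                 p t i j ≡ p t′ i′ j′
      siblings {t} {i} refl e = cong (p t i) (L.Grandkids.injective t i e)

      adj⁻ : ∀ x y → Adj G (at x) (at y) → DAdj x y
      adj⁻ (c t)     (c t′)       e = cc t t′ λ { refl → Adj-irrefl G e }
      adj⁻ (c t)     (l t′ i)     e = subst (λ u → DAdj (c t) (l u i)) (kid-centre {t} {t′} {i} e) (cl t i)
      adj⁻ (c t)     (p t′ i j)   e = contradiction e (centre≁grandkid (isC t) (L.grandkid-isGrandkid t′ i j))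
      adj⁻ (l t i)   (c t′)       e =
        subst (λ u → DAdj (l t i) (c u)) (≡.sym (kid-centre {t′} {t} {i} (Adj-sym G e))) (lc t i)
      adj⁻ (l t i)   (l t′ i′)    e = contradiction e (kid≁kid (L.kid-isKid t i) (L.kid-isKid t′ i′))
      adj⁻ (l t i)   (p t′ i′ j)  e = lp≡ (grandkid-parent t i t′ i′ j e)
      adj⁻ (p t i j) (c t′)       e = contradiction (Adj-sym G e) (centre≁grandkid (isC t′) (L.grandkid-isGrandkid t i j))
      adj⁻ (p t i j) (l t′ i′)    e = pl≡ (grandkid-parent t′ i′ t i j (Adj-sym G e))
      adj⁻ (p t i j) (p t′ i′ j′) e =
        contradiction e (grandkid≁grandkid (L.grandkid-isGrandkid t i j) (L.grandkid-isGrandkid t′ i′ j′))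

      injective : ∀ x y → at x ≡ at y → x ≡ y
      injective (c t)     (c t′)       e = cong c (centre-injective e)
      injective (c t)     (l t′ i)     e = contradiction e (centre≢kid (isC t) (L.kid-isKid t′ i))
      injective (c t)     (p t′ i j)   e = contradiction e (centre≢grandkid (isC t) (L.grandkid-isGrandkid t′ i j))
      injective (l t i)   (c t′)       e = contradiction (≡.sym e) (centre≢kid (isC t′) (L.kid-isKid t i))
      injective (l t i)   (l t′ i′)    e = kid-injective t i t′ i′ e
      injective (l t i)   (p t′ i′ j)  e = contradiction e (kid≢grandkid (L.kid-isKid t i) (L.grandkid-isGrandkid t′ i′ j))
      injective (p t i j) (c t′)       e = contradiction (≡.sym e) (centre≢grandkid (isC t′) (L.grandkid-isGrandkid t i j))
      injective (p t i j) (l t′ i′)    e =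
        contradiction (≡.sym e) (kid≢grandkid (L.kid-isKid t′ i′) (L.grandkid-isGrandkid t i j))
      injective (p t i j) (p t′ i′ j′) e =
        siblings (grandkid-parent t i t′ i′ j′ (subst (Adj G (L.kid t i)) e (lp⁺ t i j))) e

      index : ∀ {z z′} → Centre z z′ → ∃ λ t → centre t ≡ z × other t ≡ z′
      index first  = zero , refl , refl
      index second = suc zero , refl , refl

      surjective : ∀ x → ∃ λ y → at y ≡ x
      surjective x with place x
      ... | isCentre cen with index cen
      ...   | t , refl , _ = c t , refl
      surjective x | isKid (mkKid cen zx x≢z′) with index cen
      ... | t , refl , refl with L.Kids.surjective t zx x≢z′
      ...   | i , e = l t i , e
      surjective x | isGrandkid (mkGrandkid (mkKid cen zv v≢z′) vx x≢z) with index cen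
      ... | t , refl , refl with L.Kids.surjective t zv v≢z′
      ...   | i , refl with L.Grandkids.surjective t i vx x≢z
      ...     | j , e = p t i j , e

      labelling : Labelling G (DV a b) DAdj
      labelling = record
        { at = at ; injective = injective ; surjective = surjective ; adj⁺ = adj⁺ ; adj⁻ = adj⁻ }

    -- Parameters of the model

    family : ∃ (λ b → 1 ≤ b × ∀ {z z′} → Centre z z′ → Broom z z′ b) → InFamilyT G
    family (b , 1≤b , broom) with joined
    ... | inj₁ refl = inj₁ (_ , b , 2≤m , 1≤b , Labelling⇒IsoTo (Star.labelling broom refl))
      where
      m = length (kids z₀ z₀)
      n≡ : n ≡ suc (m * suc b)
      -- The excluded vertex is `z₀` itself, whose branch is empty for want of loops.
      n≡ = ≡.trans (order-by-broom (broom first)) (cong (λ k → suc (k + m * suc b)) (branch-nonadjacent (Adj-irrefl G)))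
      -- A kid lies above the centre only if its branch, of `suc b` vertices, is less than half the
      -- tree; so there are at least two such branches.
      small-branch : ∃ (λ v → Kid z₀ z₀ v) → 2 * suc b ≤ m * suc b
      small-branch (v , k) = ≤-pred (begin
        suc (2 * suc b)                  ≡⟨ cong (λ t → suc (suc b + t)) (+-identityʳ (suc b)) ⟩
        suc (suc b + suc b)              ≤⟨ +-cancelˡ-≤ (s z₀) _ _ (begin
          s z₀ + suc (suc b + suc b)       ≡⟨ +-suc (s z₀) _ ⟩
          suc (s z₀) + (suc b + suc b)     ≤⟨ +-monoˡ-≤ (suc b + suc b) (Kid.below k) ⟩
          s v + (suc b + suc b)            ≡⟨ broom-kid-status (broom first) (Kid.edge k) (Kid.other k) ⟩
          s z₀ + n                         ∎) ⟩
        n                                ≡⟨ n≡ ⟩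
        suc (m * suc b)                  ∎)
        where open ≤-Reasoning
      some-kid : ∃ λ v → Kid z₀ z₀ v
      some-kid with some-grandkid
      ... | _ , _ , v , _ , g with single-centre refl (Kid.centre (Grandkid.kid g))
      ...   | refl , refl = v , Grandkid.kid g
      2≤m : 2 ≤ m
      2≤m = *-cancelʳ-≤ 2 m (suc b) (small-branch some-kid)
    ... | inj₂ z₀z₁ = inj₂ (_ , b , 1≤a some-grandkid , 1≤b ,
                            Labelling⇒IsoTo (DoubleStar.labelling broom z₀z₁ refl same-length))
      where
      balanced : branch z₀ z₁ ≡ branch z₁ z₀
      balanced = +-cancelˡ-≡ (s z₀) _ _ (≡.trans (cong (_+ branch z₀ z₁) (≡.sym equal)) (≡.sym (status-branch z₀z₁)))
      -- Count `n` from either centre: the opposite halves are equal, and each kid contributes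
      -- `suc b`.
      same-length : length (kids z₀ z₁) ≡ length (kids z₁ z₀)
      same-length = *-cancelʳ-≡ _ _ (suc b) (+-cancelˡ-≡ (branch z₁ z₀) _ _ (suc-injective (begin
        suc (branch z₁ z₀ + length (kids z₀ z₁) * suc b)  ≡⟨ order-by-broom (broom second) ⟨
        n                                                 ≡⟨ order-by-broom (broom first) ⟩
        suc (branch z₀ z₁ + length (kids z₁ z₀) * suc b)  ≡⟨ cong (λ k → suc (k + length (kids z₁ z₀) * suc b)) balanced ⟩
        suc (branch z₁ z₀ + length (kids z₁ z₀) * suc b)  ∎)))
        where open ≡.≡-Reasoning
      1≤a : ∃ (λ z → ∃ λ z′ → ∃ λ v → ∃ λ w → Grandkid z z′ v w) → 1 ≤ length (kids z₁ z₀)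
      1≤a (_ , _ , _ , _ , mkGrandkid (mkKid first zv v≢z′) _ _)  = ∈-length (kids⁺ zv v≢z′)
      1≤a (_ , _ , _ , _ , mkGrandkid (mkKid second zv v≢z′) _ _) =
        subst (1 ≤_) same-length (∈-length (kids⁺ zv v≢z′))

  kG≡3⇒family : kG G ≡ 3 → InFamilyT G
  kG≡3⇒family kG≡3 with least-status (subst (1 ≤_) (≡.sym kG≡3) (s≤s z≤n))
  ... | z₀ , minimal with median z₀ minimal
  ...   | z₁ , med = FromMedian.family kG≡3 med (FromMedian.brooms kG≡3 med)

  family⇒kG≡3 : InFamilyT G → kG G ≡ 3
  family⇒kG≡3 (inj₁ (_ , _ , 2≤m , 1≤b , iso)) = star⇒kG≡3 2≤m 1≤b (IsoTo⇒Labelling iso)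
  family⇒kG≡3 (inj₂ (_ , _ , 1≤a , 1≤b , iso)) = doubleStar⇒kG≡3 1≤a 1≤b (IsoTo⇒Labelling iso)

theorem3p6 : (n : ℕ) (T : Graph n) → IsTree T → (kG T ≡ 3 ⇔ InFamilyT T)
theorem3p6 n T tree = mk⇔ (Tree.kG≡3⇒family tree) (Tree.family⇒kG≡3 tree)
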